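{- There is a constant $C$ such that for every $n$, $s(n, \chi_{>3}) \leq \frac{21}{64} n^2 + Cn$, both when Mini moves first and when Max moves first.
   Context: Let $\mathcal{P}$ be a monotone increasing property of graphs on vertex set $[n]$. An edge $e \in \binom{[n]}{2}\setminus E(G)$ is legal with respect to a graph $G \notin \mathcal{P}$ if $G \cup \{e\} \notin \mathcal{P}$. The saturation game $(n,\mathcal{P})$: starting from the empty graph on $[n]$, two players, Mini and Max, alternately add a legal edge to the current graph $G$. The game ends when no legal edge exists. Max wants to maximize the number of edges of the final graph and Mini wants to minimize it. The score $s(n,\mathcal{P})$ is the number of edges of the final graph under optimal play by both players; it may depend on which player moves first. $\chi_{>k}$ denotes the property of having chromatic number at least $k+1$. -}

module Defs where

open import Data.Nat using (ℕ; zero; suc; _+_; _*_; _≤_)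
open import Data.Bool using (Bool; true; false; _∨_; _∧_; if_then_else_)
open import Data.Fin using (Fin; _<_)
import Data.Fin as Fin
open import Data.List using (List; length; filter; allFin; concatMap; map)
open import Data.Product using (Σ; _×_; _,_)
open import Relation.Nullary using (¬_; does)
open import Relation.Binary.PropositionalEquality using (_≡_; _≢_)

-- A (simple) graph on vertex set Fin n.  An undirected edge {i,j} is
-- present iff  G i j ∨ G j i  (we only ever set entries with i < j).
Graph : ℕ → Set
Graph n = Fin n → Fin n → Bool

emptyGraph : (n : ℕ) → Graph n
emptyGraph n _ _ = false

adj : ∀ {n} → Graph n → Fin n → Fin n → Bool
adj G i j = G i j ∨ G j i

addEdge : ∀ {n} → Graph n → Fin n → Fin n → Graph n
addEdge G i j a b = if does (a Fin.≟ i) ∧ does (b Fin.≟ j) then true else G a b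

edgeCount : ∀ {n} → Graph n → ℕ
edgeCount {n} G =
  length (filter (λ p → adj G (Data.Product.proj₁ p) (Data.Product.proj₂ p) Data.Bool.≟ true)
    (filter (λ p → Data.Product.proj₁ p Fin.<? Data.Product.proj₂ p)
      (concatMap (λ i → map (λ j → (i , j)) (allFin n)) (allFin n))))
  where import Data.Product; import Data.Bool

Colorable3 : ∀ {n} → Graph n → Set
Colorable3 {n} G = Σ (Fin n → Fin 3) λ c → ∀ i j → adj G i j ≡ true → c i ≢ c j

Legal : ∀ {n} → Graph n → Fin n → Fin n → Set
Legal G i j = (i < j) × (adj G i j ≡ false) × Colorable3 (addEdge G i j)

Terminal : ∀ {n} → Graph n → Set
Terminal G = ∀ i j → ¬ Legal G i j

data Player : Set where
  mini maxi : Player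

-- MiniForces k p G : in the saturation game (n, χ_{>3}) at position G with
-- player p to move, Mini has a strategy ensuring the final graph has at
-- most k edges, whatever Max does.  (Since the game is finite, this holds
-- iff the score under optimal play is ≤ k.)
data MiniForces {n : ℕ} (k : ℕ) : Player → Graph n → Set where
  done    : ∀ {p G} → Terminal G → edgeCount G ≤ k → MiniForces k p G
  miniMove : ∀ {G} i j → Legal G i j → MiniForces k maxi (addEdge G i j) →
             MiniForces k mini G
  maxMove : ∀ {G} → ¬ Terminal G →
            (∀ i j → Legal G i j → MiniForces k mini (addEdge G i j)) →
            MiniForces k maxi G

ScoreAtMost : (n : ℕ) → Player → ℕ → Set
ScoreAtMost n p k = MiniForces {n} k p (emptyGraph n)

{-# OPTIONS --safe #-}
module Submission where

-- Call the colour of vertex 0 the base colour.  Mini keeps the base class below about n/4 by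
-- joining vertices w to vertex 0 ("marking" w).  The vertices not yet forced into or out of the
-- base class, together with some marked ones, form disjoint bipartite pieces, called trees below
-- although they may contain even cycles, each with exactly one unmarked vertex, its root.  When
-- Max joins two trees, Mini marks one of the two roots; when he joins a tree to a vertex settled
-- outside the base class, she marks its root, which settles the whole tree.
-- A vertex can be forced into the base class only as the root of a tree in which Max closes an odd
-- cycle.  That tree has at least two further vertices, which are then settled outside the base
-- class, and Mini has a spare move to mark the root of another tree.  So each base vertex is paid
-- for by three others, and a 3-partite graph with a class of size x ≤ n/4 + O(1) has at most
-- x(n − x) + (n − x)²/4 ≤ 21n²/64 + O(n) edges.

open import Defs
open import Algebra.Properties.Semiring.Sum using ()
open import Data.Bool using (Bool; true; false; _∧_; _∨_; not; _xor_; if_then_else_)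
import Data.Bool as Bool
open import Data.Bool.Properties using (∨-comm; ∨-zeroʳ; not-¬; ¬-not; xor-comm; xor-identityʳ)
open import Data.Empty using (⊥; ⊥-elim)
open import Data.Fin using (Fin; zero; suc; _≟_; _<?_)
import Data.Fin as Fin
open import Data.Fin.Properties using (<-asym; <⇒≢; any?; all?; finToFun-funToFin)
open import Data.List using (List; []; _∷_; _++_; length; filter; map; concatMap; allFin; tabulate)
open import Data.Nat using (ℕ; zero; suc; _+_; _*_; _≤_; _<_; z≤n; s≤s)
import Data.Nat as ℕ
open import Data.Nat.DivMod using (_/_; m/n*n≤m; m*n/n≡m; /-monoˡ-≤)
open import Data.Nat.Induction using (<-wellFounded)
import Data.Nat.ListAction as List
open import Data.Nat.Properties hiding (_≟_; _<?_; <-asym; <⇒≢)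
open import Data.Nat.Tactic.RingSolver using (solve-∀)
open import Data.Product using (Σ; ∃; _×_; _,_; proj₁; proj₂)
open import Data.Sum using (_⊎_; inj₁; inj₂; map₂; swap)
open import Data.Unit using (⊤; tt)
open import Function using (_∘_)
open import Induction.WellFounded using (Acc; acc)
open import Level using (0ℓ)
open import Relation.Binary.PropositionalEquality
open import Relation.Nullary using (¬_; Dec; yes; no; does)
open import Relation.Nullary.Decidable using (from-yes; _→-dec_; _×-dec_; ¬?; map′; dec-true; dec-false)
open import Relation.Unary using (Pred; Decidable)

open Algebra.Properties.Semiring.Sum +-*-semiring
  using (sum; ∑-distrib-+; ∑-comm; sum-cong-≗; sum-replicate-zero; *-distribˡ-sum; *-distribʳ-sum)

-- Counting edges across three colour classes

ind : Bool → ℕ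
ind true  = 1
ind false = 0

sum-mono-≤ : ∀ {n} {f g : Fin n → ℕ} → (∀ i → f i ≤ g i) → sum f ≤ sum g
sum-mono-≤ {zero}  f≤g = z≤n
sum-mono-≤ {suc n} f≤g = +-mono-≤ (f≤g zero) (sum-mono-≤ (f≤g ∘ suc))

δ : ∀ {n} → Fin n → Fin n → ℕ
δ i j = ind (does (i ≟ j))

sum-δ : ∀ {n} (i : Fin n) → sum (δ i) ≡ 1
sum-δ {suc n} zero    = cong suc (sum-replicate-zero n)
sum-δ         (suc i) = sum-δ i

sum-+δ : ∀ {n} (f : Fin n → ℕ) i → sum (λ j → f j + δ i j) ≡ sum f + 1
sum-+δ f i = trans (∑-distrib-+ f (δ i)) (cong (sum f +_) (sum-δ i))

sum-mono-< : ∀ {n} {f g : Fin n → ℕ} i → (∀ j → f j ≤ g j) → f i < g i → sum f < sum g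
sum-mono-< {f = f} {g} i f≤g fi<gi = begin
  suc (sum f)            ≡⟨ +-comm 1 (sum f) ⟩
  sum f + 1              ≡⟨ sum-+δ f i ⟨
  sum (λ j → f j + δ i j) ≤⟨ sum-mono-≤ pointwise ⟩
  sum g                  ∎
  where
  open ≤-Reasoning
  pointwise : ∀ j → f j + δ i j ≤ g j
  pointwise j with i ≟ j
  ... | yes refl = ≤-trans (≤-reflexive (+-comm (f j) 1)) fi<gi
  ... | no _     = ≤-trans (≤-reflexive (+-identityʳ (f j))) (f≤g j)

sum-*-sum : ∀ {m n} (f : Fin m → ℕ) (g : Fin n → ℕ) → sum (λ i → sum (λ j → f i * g j)) ≡ sum f * sum g
sum-*-sum f g = trans (sum-cong-≗ (λ i → sym (*-distribˡ-sum (f i) g))) (sym (*-distribʳ-sum (sum g) f))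

listSum : {X : Set} → (X → ℕ) → List X → ℕ
listSum f = List.sum ∘ map f

listSum-++ : {X : Set} (f : X → ℕ) (xs ys : List X) → listSum f (xs ++ ys) ≡ listSum f xs + listSum f ys
listSum-++ f []       ys = refl
listSum-++ f (x ∷ xs) ys = trans (cong (f x +_) (listSum-++ f xs ys)) (sym (+-assoc (f x) _ _))

length-filter₂ : {X : Set} {P Q : Pred X 0ℓ} (P? : Decidable P) (Q? : Decidable Q) (xs : List X) →
  length (filter P? (filter Q? xs)) ≡ listSum (λ x → ind (does (Q? x) ∧ does (P? x))) xs
length-filter₂ P? Q? [] = refl
length-filter₂ P? Q? (x ∷ xs) with does (Q? x)
... | false = length-filter₂ P? Q? xs
... | true with does (P? x)
...   | false = length-filter₂ P? Q? xs
...   | true  = cong suc (length-filter₂ P? Q? xs)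

listSum-tabulate : ∀ {X : Set} {n} (f : X → ℕ) (g : Fin n → X) → listSum f (tabulate g) ≡ sum (f ∘ g)
listSum-tabulate {n = zero}  f g = refl
listSum-tabulate {n = suc n} f g = cong (f (g zero) +_) (listSum-tabulate f (g ∘ suc))

listSum-allFin : ∀ {n} (f : Fin n → ℕ) → listSum f (allFin n) ≡ sum f
listSum-allFin f = listSum-tabulate f (λ i → i)

listSum-map : {X Y : Set} (f : Y → ℕ) (g : X → Y) (xs : List X) → listSum f (map g xs) ≡ listSum (f ∘ g) xs
listSum-map f g []       = refl
listSum-map f g (x ∷ xs) = cong (f (g x) +_) (listSum-map f g xs)

listSum-concatMap : {X Y : Set} (f : Y → ℕ) (g : X → List Y) (xs : List X) →
  listSum f (concatMap g xs) ≡ listSum (listSum f ∘ g) xs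
listSum-concatMap f g []       = refl
listSum-concatMap f g (x ∷ xs) =
  trans (listSum-++ f (g x) (concatMap g xs)) (cong (listSum f (g x) +_) (listSum-concatMap f g xs))

ind-exclusive : {P Q : Set} (P? : Dec P) (Q? : Dec Q) → (P → Q → ⊥) → ∀ b →
  ind (does P? ∧ b) + ind (does Q? ∧ b) ≤ ind b
ind-exclusive (yes p) (yes q) ¬pq b = ⊥-elim (¬pq p q)
ind-exclusive (yes p) (no _)  ¬pq b = ≤-reflexive (+-identityʳ _)
ind-exclusive (no _)  (yes q) ¬pq b = ≤-refl
ind-exclusive (no _)  (no _)  ¬pq b = z≤n

edge : ∀ {n} → Graph n → Fin n → Fin n → ℕ
edge G i j = ind (does (adj G i j Bool.≟ true))

edgeCount≡sum : ∀ {n} (G : Graph n) →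
  edgeCount G ≡ sum (λ i → sum (λ j → ind (does (i <? j) ∧ does (adj G i j Bool.≟ true))))
edgeCount≡sum {n} G = begin
  edgeCount G
    ≡⟨ length-filter₂ _ _ (concatMap (λ i → map (λ j → (i , j)) (allFin n)) (allFin n)) ⟩
  listSum e (concatMap (λ i → map (λ j → (i , j)) (allFin n)) (allFin n))
    ≡⟨ listSum-concatMap e _ (allFin n) ⟩
  listSum row (allFin n)
    ≡⟨ listSum-allFin row ⟩
  sum row
    ≡⟨ sum-cong-≗ {n} (λ i → trans (listSum-map e (i ,_) (allFin n)) (listSum-allFin (λ j → e (i , j)))) ⟩
  sum (λ i → sum (λ j → e (i , j))) ∎
  where
  open ≡-Reasoning
  e : Fin n × Fin n → ℕ
  e (i , j) = ind (does (i <? j) ∧ does (adj G i j Bool.≟ true))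
  row : Fin n → ℕ
  row i = listSum e (map (i ,_) (allFin n))

-- Each pair `i < j` is seen from both of its ends. Only an inequality results, since the full
-- double sum also runs over the diagonal.
2*edgeCount≤ : ∀ {n} (G : Graph n) → edgeCount G + edgeCount G ≤ sum (λ i → sum (edge G i))
2*edgeCount≤ {n} G = begin
  edgeCount G + edgeCount G
    ≡⟨ cong₂ _+_ (edgeCount≡sum G) (trans (edgeCount≡sum G) (∑-comm up)) ⟩
  sum (λ i → sum (up i)) + sum (λ i → sum (λ j → up j i))
    ≡⟨ ∑-distrib-+ (λ i → sum (up i)) (λ i → sum (λ j → up j i)) ⟨
  sum (λ i → sum (up i) + sum (λ j → up j i))
    ≡⟨ sum-cong-≗ (λ i → ∑-distrib-+ (up i) (λ j → up j i)) ⟨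
  sum (λ i → sum (λ j → up i j + up j i))
    ≤⟨ sum-mono-≤ (λ i → sum-mono-≤ (λ j → pointwise i j)) ⟩
  sum (λ i → sum (edge G i)) ∎
  where
  open ≤-Reasoning
  up : Fin n → Fin n → ℕ
  up i j = ind (does (i <? j) ∧ does (adj G i j Bool.≟ true))
  pointwise : ∀ i j → up i j + up j i ≤ edge G i j
  pointwise i j rewrite ∨-comm (G j i) (G i j) = ind-exclusive (i <? j) (j <? i) <-asym _

-- The two sides differ by the square of the gap `d` between `x` and `y`; ordering them first avoids
-- truncated subtraction.
4xy≤[x+y]² : ∀ x y → 4 * (x * y) ≤ (x + y) * (x + y)
4xy≤[x+y]² x y with ≤-total x y
... | inj₁ x≤y with d , refl ← m≤n⇒∃[o]m+o≡n x≤y = m+n≤o⇒m≤o _ (≤-reflexive (identity x d))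
  where
  identity : ∀ x d → 4 * (x * (x + d)) + d * d ≡ (x + (x + d)) * (x + (x + d))
  identity = solve-∀
... | inj₂ y≤x with d , refl ← m≤n⇒∃[o]m+o≡n y≤x = m+n≤o⇒m≤o _ (≤-reflexive (identity y d))
  where
  identity : ∀ y d → 4 * ((y + d) * y) + d * d ≡ (y + d + y) * (y + d + y)
  identity = solve-∀

-- Up to the error term, the difference of the two sides is (m − 3x)(5m − 7x).
small-class-bound : ∀ x m → 3 * x ≤ m + 4 →
  64 * (x * m) + 16 * (m * m) ≤ 21 * ((x + m) * (x + m)) + 64 * (x + m)
small-class-bound x m 3x≤m+4 with ≤-total (3 * x) m
... | inj₁ 3x≤m with d , refl ← m≤n⇒∃[o]m+o≡n 3x≤m =
  ≤-trans (m+n≤o⇒m≤o _ (≤-reflexive (identity x d))) (m≤m+n _ _)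
  where
  identity : ∀ x d → 64 * (x * (3 * x + d)) + 16 * ((3 * x + d) * (3 * x + d)) + d * (8 * x + 5 * d)
                     ≡ 21 * ((x + (3 * x + d)) * (x + (3 * x + d)))
  identity = solve-∀
-- Here `t` is 3x - m, at most 4, so the excess t(5m - 7x) is at most 20m and fits into the linear
-- term. Adding `7 * (x * t)` on the left turns the excess into 5mt, and the regrouping exposes
-- `m + t` and `3 * x` so that each can be exchanged for the other.
... | inj₂ m≤3x with t , m+t≡3x ← m≤n⇒∃[o]m+o≡n m≤3x = begin
  64 * (x * m) + 16 * (m * m)
    ≤⟨ m≤m+n _ (7 * (x * t)) ⟩
  64 * (x * m) + 16 * (m * m) + 7 * (x * t)
    ≡⟨ split x m t ⟩
  42 * (x * m) + 16 * (m * m) + (7 * (x * (m + t)) + 5 * (m * (3 * x)))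
    ≡⟨ cong₂ (λ u v → 42 * (x * m) + 16 * (m * m) + (7 * (x * u) + 5 * (m * v))) m+t≡3x (sym m+t≡3x) ⟩
  42 * (x * m) + 16 * (m * m) + (7 * (x * (3 * x)) + 5 * (m * (m + t)))
    ≡⟨ collect x m t ⟩
  21 * ((x + m) * (x + m)) + 5 * (m * t)
    ≤⟨ +-monoʳ-≤ (21 * ((x + m) * (x + m))) error ⟩
  21 * ((x + m) * (x + m)) + 64 * (x + m) ∎
  where
  open ≤-Reasoning
  split : ∀ x m t → 64 * (x * m) + 16 * (m * m) + 7 * (x * t)
                    ≡ 42 * (x * m) + 16 * (m * m) + (7 * (x * (m + t)) + 5 * (m * (3 * x)))
  split = solve-∀
  collect : ∀ x m t → 42 * (x * m) + 16 * (m * m) + (7 * (x * (3 * x)) + 5 * (m * (m + t)))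
                      ≡ 21 * ((x + m) * (x + m)) + 5 * (m * t)
  collect = solve-∀
  regroup : ∀ x m → 5 * (m * 4) + (64 * x + 44 * m) ≡ 64 * (x + m)
  regroup = solve-∀
  t≤4 : t ≤ 4
  t≤4 = +-cancelˡ-≤ m t 4 (≤-trans (≤-reflexive m+t≡3x) 3x≤m+4)
  error : 5 * (m * t) ≤ 64 * (x + m)
  error = ≤-trans (*-monoʳ-≤ 5 (*-monoʳ-≤ m t≤4)) (m+n≤o⇒m≤o _ (≤-reflexive (regroup x m)))

-- Proper 3-colourings and the sizes of their classes

Proper : ∀ {n} → Graph n → (Fin n → Fin 3) → Set
Proper G c = ∀ i j → adj G i j ≡ true → c i ≢ c j

-- Relative to a base colour `p` the two remaining colours become bits, so that exchanging them is
-- an `xor`.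
other : Fin 3 → Bool → Fin 3
other zero             false = suc zero
other zero             true  = suc (suc zero)
other (suc zero)       false = zero
other (suc zero)       true  = suc (suc zero)
other (suc (suc zero)) false = zero
other (suc (suc zero)) true  = suc zero

other≢ : ∀ p b → other p b ≢ p
other≢ zero             false ()
other≢ zero             true  ()
other≢ (suc zero)       false ()
other≢ (suc zero)       true  ()
other≢ (suc (suc zero)) false ()
other≢ (suc (suc zero)) true  ()

other-injective : ∀ p {b b′} → other p b ≡ other p b′ → b ≡ b′
other-injective _                {false} {false} _ = refl
other-injective _                {true}  {true}  _ = refl
other-injective zero             {false} {true}  ()
other-injective zero             {true}  {false} ()
other-injective (suc zero)       {false} {true}  ()
other-injective (suc zero)       {true}  {false} ()
other-injective (suc (suc zero)) {false} {true}  ()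
other-injective (suc (suc zero)) {true}  {false} ()

other-surjective : ∀ p q → q ≢ p → ∃ λ b → q ≡ other p b
other-surjective zero             zero             q≢p = ⊥-elim (q≢p refl)
other-surjective zero             (suc zero)       q≢p = false , refl
other-surjective zero             (suc (suc zero)) q≢p = true , refl
other-surjective (suc zero)       zero             q≢p = false , refl
other-surjective (suc zero)       (suc zero)       q≢p = ⊥-elim (q≢p refl)
other-surjective (suc zero)       (suc (suc zero)) q≢p = true , refl
other-surjective (suc (suc zero)) zero             q≢p = false , refl
other-surjective (suc (suc zero)) (suc zero)       q≢p = true , refl
other-surjective (suc (suc zero)) (suc (suc zero)) q≢p = ⊥-elim (q≢p refl)

classSize : ∀ {n} → (Fin n → Fin 3) → Fin 3 → ℕ
classSize c k = sum (λ i → δ (c i) k)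

δ-partition : ∀ p q → δ q p + (δ q (other p false) + δ q (other p true)) ≡ 1
δ-partition = from-yes (all? λ p → all? λ q → δ q p + (δ q (other p false) + δ q (other p true)) ℕ.≟ 1)

sum-const : ∀ n k → sum {n} (λ _ → k) ≡ n * k
sum-const zero    k = refl
sum-const (suc n) k = cong (k +_) (sum-const n k)

classSize-total : ∀ {n} (c : Fin n → Fin 3) p →
  classSize c p + (classSize c (other p false) + classSize c (other p true)) ≡ n
classSize-total {n} c p = begin
  sum a + (sum b + sum d)            ≡⟨ cong (sum a +_) (∑-distrib-+ b d) ⟨
  sum a + sum (λ i → b i + d i)      ≡⟨ ∑-distrib-+ a (λ i → b i + d i) ⟨
  sum (λ i → a i + (b i + d i))      ≡⟨ sum-cong-≗ (λ i → δ-partition p (c i)) ⟩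
  sum {n} (λ _ → 1)                  ≡⟨ sum-const n 1 ⟩
  n * 1                              ≡⟨ *-identityʳ n ⟩
  n                                  ∎
  where
  open ≡-Reasoning
  a b d : Fin n → ℕ
  a i = δ (c i) p
  b i = δ (c i) (other p false)
  d i = δ (c i) (other p true)

-- An indicator of q ≢ r in a form whose double sum factors.
crossing : Fin 3 → Fin 3 → Fin 3 → ℕ
crossing p q r = δ q p * (δ r (other p false) + δ r (other p true))
  + (δ q (other p false) * (δ r p + δ r (other p true)) + δ q (other p true) * (δ r p + δ r (other p false)))

crossing-positive : ∀ p q r → q ≢ r → 1 ≤ crossing p q r
crossing-positive = from-yes (all? λ p → all? λ q → all? λ r → ¬? (q ≟ r) →-dec (1 ℕ.≤? crossing p q r))

edges-between-classes : ∀ {n} (G : Graph n) c p → Proper G c →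
  let X = classSize c p
      Y = classSize c (other p false)
      Z = classSize c (other p true)
  in sum (λ i → sum (edge G i)) ≤ X * (Y + Z) + (Y * (X + Z) + Z * (X + Y))
edges-between-classes {n} G c p proper = begin
  sum (λ i → sum (edge G i))
    ≤⟨ sum-mono-≤ (λ i → sum-mono-≤ (λ j → pointwise i j)) ⟩
  sum (λ i → sum (λ j → a i * (b j + d j) + (b i * (a j + d j) + d i * (a j + b j))))
    ≡⟨ split _ _ ⟩
  sum (λ i → sum (λ j → a i * (b j + d j))) + sum (λ i → sum (λ j → b i * (a j + d j) + d i * (a j + b j)))
    ≡⟨ cong₂ _+_ (product a b d) (trans (split _ _) (cong₂ _+_ (product b a d) (product d a b))) ⟩
  sum a * (sum b + sum d) + (sum b * (sum a + sum d) + sum d * (sum a + sum b)) ∎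
  where
  open ≤-Reasoning
  a b d : Fin n → ℕ
  a i = δ (c i) p
  b i = δ (c i) (other p false)
  d i = δ (c i) (other p true)
  split : (f g : Fin n → Fin n → ℕ) →
    sum (λ i → sum (λ j → f i j + g i j)) ≡ sum (λ i → sum (f i)) + sum (λ i → sum (g i))
  split f g = trans (sum-cong-≗ (λ i → ∑-distrib-+ (f i) (g i))) (∑-distrib-+ (λ i → sum (f i)) (λ i → sum (g i)))
  product : (f g h : Fin n → ℕ) → sum (λ i → sum (λ j → f i * (g j + h j))) ≡ sum f * (sum g + sum h)
  product f g h = trans (sum-*-sum f (λ j → g j + h j)) (cong (sum f *_) (∑-distrib-+ g h))
  pointwise : ∀ i j → edge G i j ≤ a i * (b j + d j) + (b i * (a j + d j) + d i * (a j + b j))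
  pointwise i j with adj G i j Bool.≟ true
  ... | yes ij = crossing-positive p (c i) (c j) (proper i j ij)
  ... | no _   = z≤n

-- Let x be the size of class `p` and m = n - x. At most xm edges meet the class and at most m²/4
-- join the other two, and the size hypothesis reads 3x ≤ m + 4.
edgeCount-bound : ∀ {n} (G : Graph n) c p → Proper G c → 4 * classSize c p ≤ n + 4 →
  64 * edgeCount G ≤ 21 * (n * n) + 64 * n
edgeCount-bound {n} G c p proper small = begin
  64 * edgeCount G                             ≡⟨ double (edgeCount G) ⟩
  32 * (edgeCount G + edgeCount G)             ≤⟨ *-monoʳ-≤ 32 (≤-trans (2*edgeCount≤ G) (edges-between-classes G c p proper)) ⟩
  32 * (X * (Y + Z) + (Y * (X + Z) + Z * (X + Y))) ≡⟨ regroup X Y Z ⟩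
  64 * (X * (Y + Z)) + 16 * (4 * (Y * Z))      ≤⟨ +-monoʳ-≤ (64 * (X * (Y + Z))) (*-monoʳ-≤ 16 (4xy≤[x+y]² Y Z)) ⟩
  64 * (X * (Y + Z)) + 16 * ((Y + Z) * (Y + Z)) ≤⟨ small-class-bound X (Y + Z) 3X≤ ⟩
  21 * ((X + (Y + Z)) * (X + (Y + Z))) + 64 * (X + (Y + Z)) ≡⟨ cong (λ k → 21 * (k * k) + 64 * k) total ⟩
  21 * (n * n) + 64 * n ∎
  where
  open ≤-Reasoning
  X = classSize c p
  Y = classSize c (other p false)
  Z = classSize c (other p true)
  total : X + (Y + Z) ≡ n
  total = classSize-total c p
  3X≤ : 3 * X ≤ Y + Z + 4
  3X≤ = +-cancelˡ-≤ X _ _ (≤-trans small (≤-reflexive (trans (cong (_+ 4) (sym total)) (+-assoc X (Y + Z) 4))))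
  double : ∀ e → 64 * e ≡ 32 * (e + e)
  double = solve-∀
  regroup : ∀ x y z → 32 * (x * (y + z) + (y * (x + z) + z * (x + y))) ≡ 64 * (x * (y + z)) + 16 * (4 * (y * z))
  regroup = solve-∀

-- Graph extensions

private variable
  n : ℕ
  G H : Graph n

∨-elim : ∀ {a b} → a ∨ b ≡ true → a ≡ true ⊎ b ≡ true
∨-elim {true}  _ = inj₁ refl
∨-elim {false} e = inj₂ e

∨-introˡ : ∀ {a} b → a ≡ true → a ∨ b ≡ true
∨-introˡ b refl = refl

∨-introʳ : ∀ a {b} → b ≡ true → a ∨ b ≡ true
∨-introʳ a refl = ∨-zeroʳ a

adj-sym : (G : Graph n) → ∀ {x y} → adj G x y ≡ true → adj G y x ≡ true
adj-sym G {x} {y} = trans (∨-comm (G y x) (G x y))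

infix 4 _⊑_
-- Wrapped in a record so that `G` and `H` stay visible to unification.
record _⊑_ (G H : Graph n) : Set where
  constructor subgraph
  field
    include : ∀ x y → adj G x y ≡ true → adj H x y ≡ true

open _⊑_

⊑-refl : {G : Graph n} → G ⊑ G
⊑-refl = subgraph λ _ _ e → e

⊑-trans : ∀ {K : Graph n} → G ⊑ H → H ⊑ K → G ⊑ K
⊑-trans G⊑H H⊑K = subgraph λ x y xy → include H⊑K x y (include G⊑H x y xy)

-- Phrased through `adj` alone, hence symmetric in `i` and `j` although `addEdge` sets a single
-- entry; `reply` relies on this to swap the ends of Max's edge.
record Extends (G : Graph n) (i j : Fin n) (H : Graph n) : Set where
  field
    grows : G ⊑ H
    new   : adj H i j ≡ true
    only  : ∀ x y → adj H x y ≡ true → adj G x y ≡ true ⊎ (x ≡ i × y ≡ j) ⊎ (x ≡ j × y ≡ i)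

open Extends

Extends-sym : ∀ {i j} → Extends {n} G i j H → Extends G j i H
Extends-sym {H = H} ext = record
  { grows = grows ext
  ; new   = adj-sym H (new ext)
  ; only  = λ x y xy → map₂ swap (only ext x y xy) }

addEdge-extends : ∀ (G : Graph n) i j → Extends G i j (addEdge G i j)
addEdge-extends G i j = record
  { grows = subgraph λ x y xy → grows′ x y (∨-elim xy)
  ; new   = ∨-introˡ _ new′
  ; only  = λ x y xy → only′ x y (∨-elim xy) }
  where
  old : ∀ a b → G a b ≡ true → addEdge G i j a b ≡ true
  old a b ab with does (a ≟ i) ∧ does (b ≟ j)
  ... | true  = refl
  ... | false = ab
  entry : ∀ a b → addEdge G i j a b ≡ true → G a b ≡ true ⊎ (a ≡ i × b ≡ j)
  entry a b ab with a ≟ i | b ≟ j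
  ... | yes p | yes q = inj₂ (p , q)
  ... | yes _ | no _  = inj₁ ab
  ... | no _  | _     = inj₁ ab
  new′ : addEdge G i j i j ≡ true
  new′ rewrite dec-true (i ≟ i) refl | dec-true (j ≟ j) refl = refl
  grows′ : ∀ x y → G x y ≡ true ⊎ G y x ≡ true → adj (addEdge G i j) x y ≡ true
  grows′ x y (inj₁ xy) = ∨-introˡ _ (old x y xy)
  grows′ x y (inj₂ yx) = ∨-introʳ _ (old y x yx)
  only′ : ∀ x y → addEdge G i j x y ≡ true ⊎ addEdge G i j y x ≡ true →
    adj G x y ≡ true ⊎ (x ≡ i × y ≡ j) ⊎ (x ≡ j × y ≡ i)
  only′ x y (inj₁ xy) with entry x y xy
  ... | inj₁ e = inj₁ (∨-introˡ _ e)
  ... | inj₂ e = inj₂ (inj₁ e)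
  only′ x y (inj₂ yx) with entry y x yx
  ... | inj₁ e       = inj₁ (∨-introʳ _ e)
  ... | inj₂ (p , q) = inj₂ (inj₂ (q , p))

Proper-anti : G ⊑ H → ∀ {c} → Proper {n} H c → Proper G c
Proper-anti G⊑H proper i j = proper i j ∘ include G⊑H i j

Proper-extend : ∀ {i j c} → Extends {n} G i j H → Proper G c → c i ≢ c j → Proper H c
Proper-extend ext proper ci≢cj x y xy with only ext x y xy
... | inj₁ e                    = proper x y e
... | inj₂ (inj₁ (refl , refl)) = ci≢cj
... | inj₂ (inj₂ (refl , refl)) = ci≢cj ∘ sym

-- The measure for the recursion over the game: every move lowers it.
nonEdges : Graph n → ℕ
nonEdges G = sum (λ i → sum (λ j → ind (not (adj G i j))))

nonEdges-< : ∀ {i j} → Extends {n} G i j H → adj G i j ≡ false → nonEdges H < nonEdges G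
nonEdges-< {G = G} {H} {i} {j} ext fresh =
  sum-mono-< i (λ x → sum-mono-≤ (pointwise x)) (sum-mono-< j (pointwise i) strict)
  where
  pointwise : ∀ x y → ind (not (adj H x y)) ≤ ind (not (adj G x y))
  pointwise x y with adj G x y in xy
  ... | true rewrite include (grows ext) x y xy = z≤n
  ... | false with adj H x y
  ...   | true  = z≤n
  ...   | false = ≤-refl
  strict : ind (not (adj H i j)) < ind (not (adj G i j))
  strict rewrite fresh | new ext = ≤-refl

-- Colourings are searched through their codes below 3^n. Decoding returns a colouring only
-- pointwise, so properness is transported entry by entry.
colorable? : (G : Graph n) → Dec (Colorable3 G)
colorable? {n} G = map′
  (λ (k , proper) → Fin.finToFun k , proper)
  (λ (c , proper) → Fin.funToFin c , λ i j ij e → proper i j ij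
    (trans (sym (finToFun-funToFin c i)) (trans e (finToFun-funToFin c j))))
  (any? {3 ℕ.^ n} λ k → all? λ i → all? λ j →
    (adj G i j Bool.≟ true) →-dec ¬? (Fin.finToFun k i ≟ Fin.finToFun k j))

legalMove? : (G : Graph n) → Dec (∃ λ i → ∃ λ j → Legal G i j)
legalMove? G = any? λ i → any? λ j →
  (i <? j) ×-dec (adj G i j Bool.≟ false) ×-dec colorable? (addEdge G i j)

-- Configurations and Mini's invariant

-- anchored: forced into the base class; settled: forced out of it; active: in a tree.
data Class : Set where
  anchored settled active : Class

active? : ∀ t → Dec (t ≡ active)
active? anchored = no λ ()
active? settled  = no λ ()
active? active   = yes refl

Forced : Class → Graph (suc n) → Fin (suc n) → Set
Forced anchored G x = ∀ c → Proper G c → c x ≡ c zero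
Forced settled  G x = ∀ c → Proper G c → c x ≢ c zero
Forced active   G x = ⊤

-- More edges leave fewer proper colourings to quantify over.
Forced-mono : ∀ t {x} → G ⊑ H → Forced {n} t G x → Forced t H x
Forced-mono anchored G⊑H f c proper = f c (Proper-anti G⊑H proper)
Forced-mono settled  G⊑H f c proper = f c (Proper-anti G⊑H proper)
Forced-mono active   G⊑H f          = tt

-- root and side have junk values outside the active vertices.
record Config (n : ℕ) : Set where
  constructor config
  field
    cls  : Fin n → Class
    root : Fin n → Fin n
    side : Fin n → Bool

open Config

InTree : Config n → Fin n → Fin n → Set
InTree S w x = cls S x ≡ active × root S x ≡ w

-- Where an edge from an active `x` may lead: to the base class if `x` is not a root, or across its
-- own tree. So a root has no neighbour in the base class, and no active vertex has a settled
-- neighbour.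
Placement : Config n → Fin n → Fin n → Set
Placement S x y = (cls S y ≡ anchored × root S x ≢ x) ⊎ (InTree S (root S x) y × side S x ≢ side S y)

Fits : Config n → Fin n → Fin n → Set
Fits S x y = cls S x ≡ active → Placement S x y

-- The semantic fields forced, nonroot and two-sided quantify over all proper colourings, so they
-- survive the addition of edges; fits is what makes recolouring the trees possible.
record Inv (G : Graph (suc n)) (S : Config (suc n)) : Set where
  field
    colorable  : Colorable3 G
    zero-cls   : cls S zero ≡ anchored
    forced     : ∀ x → Forced (cls S x) G x
    root-tree  : ∀ x → cls S x ≡ active → InTree S (root S x) (root S x)
    nonroot    : ∀ x → cls S x ≡ active → root S x ≢ x → Forced settled G x
    -- Once the root avoids the base colour, the bit `b` determines the whole tree.
    two-sided  : ∀ r → InTree S r r → ∀ c → Proper G c → c r ≢ c zero →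
                 ∃ λ b → ∀ y → InTree S r y → c y ≡ other (c zero) (b xor side S y)
    fits       : ∀ x y → adj G x y ≡ true → Fits S x y
    -- Supplies a third vertex when an odd cycle is closed by an edge between the root and a vertex
    -- on the root's side; see `two-nonroots`.
    opposite   : ∀ x → cls S x ≡ active → root S x ≢ x → side S x ≡ side S (root S x) →
                 ∃ λ y → InTree S (root S x) y × side S x ≢ side S y

open Inv

anchored≢active : ∀ {t} → t ≡ anchored → t ≢ active
anchored≢active refl ()

-- Fresh colours for the trees

module _ (S : Config (suc n)) (c : Fin (suc n) → Fin 3) (β : Bool) where

  -- All trees leave the base colour at once; `β` exchanges the two remaining colours.
  recolor : Fin (suc n) → Fin 3
  recolor x with active? (cls S x)
  ... | yes _ = other (c zero) (β xor side S x)
  ... | no _  = c x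

  recolor-active : ∀ {x} → cls S x ≡ active → recolor x ≡ other (c zero) (β xor side S x)
  recolor-active {x} p with active? (cls S x)
  ... | yes _ = refl
  ... | no ¬p = ⊥-elim (¬p p)

  recolor-passive : ∀ {x} → cls S x ≢ active → recolor x ≡ c x
  recolor-passive {x} ¬p with active? (cls S x)
  ... | yes p = ⊥-elim (¬p p)
  ... | no _  = refl

allBool? : {P : Bool → Set} → (∀ b → Dec (P b)) → Dec (∀ b → P b)
allBool? P? = map′ (λ (p , q) → λ { false → p ; true → q }) (λ f → f false , f true) (P? false ×-dec P? true)

xor-cancelˡ : ∀ a {b d} → a xor b ≡ a xor d → b ≡ d
xor-cancelˡ a = from-yes (allBool? λ a → allBool? λ b → allBool? λ d →
  ((a xor b) Bool.≟ (a xor d)) →-dec (b Bool.≟ d)) a _ _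

xor-cancelʳ : ∀ a {b d} → b xor a ≡ d xor a → b ≡ d
xor-cancelʳ a {b} {d} e = xor-cancelˡ a (trans (xor-comm a b) (trans e (xor-comm d a)))

-- By `Fits`, a neighbour of an active vertex either keeps the base colour or lies across the same
-- tree. Properness of `c` is asked only between inactive vertices, so `c` may violate edges at the
-- trees.
recolor-proper : ∀ (G : Graph (suc n)) S c β →
  (∀ x → cls S x ≡ anchored → c x ≡ c zero) →
  (∀ x y → adj G x y ≡ true → cls S x ≢ active → cls S y ≢ active → c x ≢ c y) →
  (∀ x y → adj G x y ≡ true → Fits S x y) →
  Proper G (recolor S c β)
recolor-proper G S c β anch passive fit x y xy with active? (cls S x) | active? (cls S y)
... | no p | no q = λ e → passive x y xy p q e
... | yes p | no q = λ e → leave (fit x y xy p) e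
  where
  leave : Placement S x y →
    other (c zero) (β xor side S x) ≢ c y
  leave (inj₁ (a , _))       e = other≢ _ _ (trans e (anch y a))
  leave (inj₂ ((a , _) , _)) e = q a
... | no p | yes q = λ e → leave (fit y x (adj-sym G xy) q) e
  where
  leave : Placement S y x →
    c x ≢ other (c zero) (β xor side S y)
  leave (inj₁ (a , _))       e = other≢ _ _ (trans (sym e) (anch x a))
  leave (inj₂ ((a , _) , _)) e = p a
... | yes p | yes q = λ e → leave (fit x y xy p) e
  where
  leave : Placement S x y →
    other (c zero) (β xor side S x) ≢ other (c zero) (β xor side S y)
  leave (inj₁ (a , _)) e = anchored≢active a q
  leave (inj₂ (_ , differ)) e = differ (xor-cancelˡ β (other-injective (c zero) e))

anchored-const : ∀ {S} → Inv {n} G S → G ⊑ H → ∀ {c} → Proper H c → ∀ x → cls S x ≡ anchored → c x ≡ c zero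
anchored-const {G = G} inv G⊑H proper x a =
  subst (λ t → Forced t G x) a (forced inv x) _ (Proper-anti G⊑H proper)

settled-differ : ∀ {S} → Inv {n} G S → G ⊑ H → ∀ {c} → Proper H c → ∀ x → cls S x ≡ settled → c x ≢ c zero
settled-differ {G = G} inv G⊑H proper x a =
  subst (λ t → Forced t G x) a (forced inv x) _ (Proper-anti G⊑H proper)

keep : ∀ {S} → Inv {n} G S → G ⊑ H → Colorable3 H → (∀ x y → adj H x y ≡ true → Fits S x y) → Inv H S
keep {S = S} inv G⊑H col fit = record
  { colorable = col
  ; zero-cls  = zero-cls inv
  ; forced    = λ x → Forced-mono (cls S x) G⊑H (forced inv x)
  ; root-tree = root-tree inv
  ; nonroot   = λ x a r → Forced-mono settled G⊑H (nonroot inv x a r)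
  ; two-sided = λ r t c proper → two-sided inv r t c (Proper-anti G⊑H proper)
  ; fits      = fit
  ; opposite  = opposite inv
  }

-- Settling a tree

inTree? : (S : Config n) → ∀ w x → Dec (InTree S w x)
inTree? S w x = active? (cls S x) ×-dec (root S x ≟ w)

-- The fate `t` of the root is `settled` when it gets marked and `anchored` when an odd cycle
-- closes. The other vertices of the tree are already forced out of the base class, so they become
-- settled in both cases.
resolve : Config n → Fin n → Class → Config n
resolve S w t = config
  (λ x → if does (inTree? S w x) then (if does (x ≟ w) then t else settled) else cls S x)
  (root S)
  (side S)

data ResolveView (S : Config n) (w : Fin n) (t : Class) (x : Fin n) : Set where
  at-root : x ≡ w → InTree S w x → cls (resolve S w t) x ≡ t → ResolveView S w t x
  in-tree : x ≢ w → InTree S w x → cls (resolve S w t) x ≡ settled → ResolveView S w t x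
  outside : ¬ InTree S w x → cls (resolve S w t) x ≡ cls S x → ResolveView S w t x

resolveView : ∀ (S : Config n) w t x → ResolveView S w t x
resolveView S w t x with inTree? S w x in p
... | no ¬i = outside ¬i (cong (λ d → if does d then (if does (x ≟ w) then t else settled) else cls S x) p)
... | yes i with x ≟ w in q
...   | yes e = at-root e i (cong₂ (λ d d′ → if does d then (if does d′ then t else settled) else cls S x) p q)
...   | no ¬e = in-tree ¬e i (cong₂ (λ d d′ → if does d then (if does d′ then t else settled) else cls S x) p q)

resolve-active : ∀ (S : Config n) w t x → t ≢ active →
  cls (resolve S w t) x ≡ active → cls S x ≡ active × root S x ≢ w
resolve-active S w t x t≢ a with resolveView S w t x
... | at-root _ _ e = ⊥-elim (t≢ (trans (sym e) a))
... | in-tree _ _ e with () ← trans (sym e) a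
... | outside ¬i e = trans (sym e) a , λ r → ¬i (trans (sym e) a , r)

resolve-outside : ∀ (S : Config n) w t x → (cls S x ≡ active → root S x ≢ w) → cls (resolve S w t) x ≡ cls S x
resolve-outside S w t x out with resolveView S w t x
... | at-root _ (a , r) _ = ⊥-elim (out a r)
... | in-tree _ (a , r) _ = ⊥-elim (out a r)
... | outside _ e         = e

-- Trees are disjoint, so dissolving one leaves the data of the others intact; the last hypothesis
-- says that the vertices remaining active receive no new edges.
resolve-inv : ∀ {S w t} → Inv {n} G S → InTree S w w → t ≢ active → G ⊑ H → Colorable3 H → Forced t H w →
  (∀ x y → adj H x y ≡ true → cls (resolve S w t) x ≡ active → adj G x y ≡ true) →
  Inv H (resolve S w t)
resolve-inv {n} {G} {H} {S} {w} {t} inv tree t≢ G⊑H col force local = record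
  { colorable = col
  ; zero-cls  = trans (resolve-outside S w t zero (λ a → ⊥-elim (anchored≢active (zero-cls inv) a))) (zero-cls inv)
  ; forced    = forced′
  ; root-tree = λ x a → survives (root-tree inv x (old x a)) (λ r → away x a (trans (sym (proj₂ (root-tree inv x (old x a)))) r))
  ; nonroot   = λ x a r → Forced-mono settled G⊑H (nonroot inv x (old x a) r)
  ; two-sided = two-sided′
  ; fits      = fits′
  ; opposite  = opposite′
  }
  where
  S′ = resolve S w t
  old : ∀ x → cls S′ x ≡ active → cls S x ≡ active
  old x a = proj₁ (resolve-active S w t x t≢ a)
  away : ∀ x → cls S′ x ≡ active → root S x ≢ w
  away x a = proj₂ (resolve-active S w t x t≢ a)
  survives : ∀ {r y} → InTree S r y → root S y ≢ w → InTree S′ r y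
  survives {r} {y} (a , e) out = trans (resolve-outside S w t y (λ _ → out)) a , e
  forced′ : ∀ x → Forced (cls S′ x) H x
  forced′ x with resolveView S w t x
  ... | at-root refl _ e rewrite e = force
  ... | in-tree x≢w (a , r) e rewrite e =
    Forced-mono settled G⊑H (nonroot inv x a (λ r′ → x≢w (trans (sym r′) r)))
  ... | outside _ e rewrite e = Forced-mono (cls S x) G⊑H (forced inv x)
  two-sided′ : ∀ r → InTree S′ r r → ∀ c → Proper H c → c r ≢ c zero →
    ∃ λ b → ∀ y → InTree S′ r y → c y ≡ other (c zero) (b xor side S y)
  two-sided′ r (a , e) c proper ne with two-sided inv r (old r a , e) c (Proper-anti G⊑H proper) ne
  ... | b , f = b , λ y (a′ , e′) → f y (old y a′ , e′)
  fits′ : ∀ x y → adj H x y ≡ true → Fits S′ x y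
  fits′ x y xy a with fits inv x y (local x y xy a) (old x a)
  ... | inj₁ (p , r) = inj₁ (trans (resolve-outside S w t y (λ q → ⊥-elim (anchored≢active p q))) p , r)
  ... | inj₂ (i , s) = inj₂ (survives i (λ e → away x a (trans (sym (proj₂ i)) e)) , s)
  opposite′ : ∀ x → cls S′ x ≡ active → root S x ≢ x → side S x ≡ side S (root S x) →
    ∃ λ y → InTree S′ (root S x) y × side S x ≢ side S y
  opposite′ x a r s with opposite inv x (old x a) r s
  ... | y , i , ne = y , survives i (λ e → away x a (trans (sym (proj₂ i)) e)) , ne

-- The flip `not (s xor t)` puts the ends of a joining edge on opposite sides of the merged tree.
flip-sides : ∀ s t → s ≢ t xor not (s xor t)
flip-sides = from-yes (allBool? λ s → allBool? λ t → ¬? (s Bool.≟ (t xor not (s xor t))))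

-- If the joining edge is properly coloured, the second tree's colouring by `b₂` is the colouring of
-- its flipped sides by `b₁`.
flip-colors : ∀ b₁ b₂ s t u → b₁ xor s ≢ b₂ xor t → b₂ xor u ≡ b₁ xor (u xor not (s xor t))
flip-colors = from-yes (allBool? λ b₁ → allBool? λ b₂ → allBool? λ s → allBool? λ t → allBool? λ u →
  ¬? ((b₁ xor s) Bool.≟ (b₂ xor t)) →-dec ((b₂ xor u) Bool.≟ (b₁ xor (u xor not (s xor t)))))

differ-from-one : ∀ {s t u : Bool} → t ≢ u → s ≢ t ⊎ s ≢ u
differ-from-one {s} {t} t≢u with s Bool.≟ t
... | yes refl = inj₂ t≢u
... | no s≢t   = inj₁ s≢t

active≢zero : ∀ {S x} → Inv {n} G S → cls S x ≡ active → x ≢ zero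
active≢zero inv a refl = anchored≢active (zero-cls inv) a

-- Vertex 0 is anchored, and `Placement` allows an edge to an anchored vertex only from a nonroot.
root-unmarked : ∀ {S w} → Inv {n} G S → InTree S w w → adj G zero w ≢ true
root-unmarked {G = G} {w = w} inv (a , r) 0w with fits inv w zero (adj-sym G 0w) a
... | inj₁ (_ , ne)      = ne r
... | inj₂ ((p , _) , _) = anchored≢active (zero-cls inv) p

-- Max's edge avoids vertex 0, so it cannot have used up the edge with which Mini marks the root.
root-fresh : ∀ {S w i j} → Inv {n} G S → InTree S w w → Extends G i j H → i ≢ zero → j ≢ zero →
  adj H zero w ≡ false
root-fresh {H = H} {w = w} inv tree ext i≢0 j≢0 = ¬-not marked-impossible
  where
  marked-impossible : adj H zero w ≢ true
  marked-impossible 0w with only ext zero w 0w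
  ... | inj₁ e              = root-unmarked inv tree e
  ... | inj₂ (inj₁ (p , _)) = i≢0 (sym p)
  ... | inj₂ (inj₂ (p , _)) = j≢0 (sym p)

-- Joining two trees

merge : Config n → (w₁ w₂ : Fin n) → Bool → Config n
merge S w₁ w₂ f = config (cls S)
  (λ x → if does (root S x ≟ w₂) then w₁ else root S x)
  (λ x → if does (root S x ≟ w₂) then side S x xor f else side S x)

data MergeView (S : Config n) (w₁ w₂ : Fin n) (f : Bool) (x : Fin n) : Set where
  moved : root S x ≡ w₂ → root (merge S w₁ w₂ f) x ≡ w₁ → side (merge S w₁ w₂ f) x ≡ side S x xor f →
          MergeView S w₁ w₂ f x
  stays : root S x ≢ w₂ → root (merge S w₁ w₂ f) x ≡ root S x → side (merge S w₁ w₂ f) x ≡ side S x →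
          MergeView S w₁ w₂ f x

mergeView : ∀ (S : Config n) w₁ w₂ f x → MergeView S w₁ w₂ f x
mergeView S w₁ w₂ f x with root S x ≟ w₂ in e
... | yes p = moved p (cong (λ d → if does d then w₁ else root S x) e)
                      (cong (λ d → if does d then side S x xor f else side S x) e)
... | no ¬p = stays ¬p (cong (λ d → if does d then w₁ else root S x) e)
                       (cong (λ d → if does d then side S x xor f else side S x) e)

module Merge {n} {G H : Graph (suc n)} {S : Config (suc n)} {i j : Fin (suc n)}
  (inv : Inv G S) (ext : Extends G i j H) (col : Colorable3 H)
  (ai : cls S i ≡ active) (aj : cls S j ≡ active) (apart : root S i ≢ root S j) where

  private
    w₁ w₂ : Fin (suc n)
    w₁ = root S i
    w₂ = root S j
    flip : Bool
    flip = not (side S i xor side S j)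
    K : Graph (suc n)
    K = addEdge H zero w₂
    S′ : Config (suc n)
    S′ = merge S w₁ w₂ flip
    view : ∀ x → MergeView S w₁ w₂ flip x
    view = mergeView S w₁ w₂ flip
    H→K : Extends H zero w₂ K
    H→K = addEdge-extends H zero w₂
    G⊑K : G ⊑ K
    G⊑K = ⊑-trans (grows ext) (grows H→K)
    tree₁ : InTree S w₁ w₁
    tree₁ = root-tree inv i ai
    tree₂ : InTree S w₂ w₂
    tree₂ = root-tree inv j aj
    w₁-stays : root S w₁ ≢ w₂
    w₁-stays e = apart (trans (sym (proj₂ tree₁)) e)

    root-moved : ∀ {x} → root S x ≡ w₂ → root S′ x ≡ w₁
    root-moved {x} e with view x
    ... | moved _ r _ = r
    ... | stays ne _ _ = ⊥-elim (ne e)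
    root-stays : ∀ {x} → root S x ≢ w₂ → root S′ x ≡ root S x
    root-stays {x} ne with view x
    ... | moved e _ _ = ⊥-elim (ne e)
    ... | stays _ r _ = r
    side-moved : ∀ {x} → root S x ≡ w₂ → side S′ x ≡ side S x xor flip
    side-moved {x} e with view x
    ... | moved _ _ s = s
    ... | stays ne _ _ = ⊥-elim (ne e)
    side-stays : ∀ {x} → root S x ≢ w₂ → side S′ x ≡ side S x
    side-stays {x} ne with view x
    ... | moved e _ _ = ⊥-elim (ne e)
    ... | stays _ _ s = s

    root′-cong : ∀ {x y} → root S x ≡ root S y → root S′ x ≡ root S′ y
    root′-cong {x} {y} e with view x
    ... | moved p r _ = trans r (sym (root-moved (trans (sym e) p)))
    ... | stays p r _ = trans r (trans e (sym (root-stays (p ∘ trans e))))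

    side′-differ : ∀ {x y} → root S x ≡ root S y → side S x ≢ side S y → side S′ x ≢ side S′ y
    side′-differ {x} {y} e ne s with view x
    ... | moved p _ q = ne (xor-cancelʳ flip (trans (sym q) (trans s (side-moved (trans (sym e) p)))))
    ... | stays p _ q = ne (trans (sym q) (trans s (side-stays (p ∘ trans e))))

    sides-ij : side S′ i ≢ side S′ j
    sides-ij e = flip-sides (side S i) (side S j) (trans (sym (side-stays apart)) (trans e (side-moved refl)))

    tree-i : InTree S′ w₁ i
    tree-i = ai , root-stays apart
    tree-j : InTree S′ w₁ j
    tree-j = aj , root-moved refl

    nonroot-survives : ∀ {x} → root S x ≢ x → root S′ x ≢ x
    nonroot-survives {x} ne with view x
    ... | stays _ r _ = λ e → ne (trans (sym r) e)
    ... | moved p r _ = λ e → w₁-stays (trans (cong (root S) (trans (sym r) e)) p)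

    fits′ : ∀ x y → adj K x y ≡ true → Fits S′ x y
    fits′ x y xy a with only H→K x y xy
    ... | inj₂ (inj₁ (refl , _)) = ⊥-elim (active≢zero inv a refl)
    -- In the merged tree `w₂` is no longer a root, so it may have a neighbour in the base class.
    ... | inj₂ (inj₂ (refl , refl)) = inj₁ (zero-cls inv , λ e → apart (trans (sym (root-moved (proj₂ tree₂))) e))
    ... | inj₁ xy′ with only ext x y xy′
    ...   | inj₂ (inj₁ (refl , refl)) = inj₂ ((aj , trans (root-moved refl) (sym (root-stays apart))) , sides-ij)
    ...   | inj₂ (inj₂ (refl , refl)) = inj₂ ((ai , trans (root-stays apart) (sym (root-moved refl))) , sides-ij ∘ sym)
    ...   | inj₁ e with fits inv x y e a
    ...     | inj₁ (p , r)          = inj₁ (p , nonroot-survives r)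
    ...     | inj₂ ((p , r) , ne)   = inj₂ ((p , root′-cong r) , side′-differ (sym r) ne)

    colorable′ : Colorable3 K
    -- The colouring of `H` may violate Mini's edge; recolouring repairs this, because `w₂` is
    -- active and so leaves the base colour.
    colorable′ = _ , recolor-proper K S′ (proj₁ col) false
      (anchored-const inv (grows ext) (proj₂ col)) passive fits′
      where
      passive : ∀ x y → adj K x y ≡ true → cls S x ≢ active → cls S y ≢ active → proj₁ col x ≢ proj₁ col y
      passive x y xy p q with only H→K x y xy
      ... | inj₁ e                    = proj₂ col x y e
      ... | inj₂ (inj₁ (refl , refl)) = ⊥-elim (q (proj₁ tree₂))
      ... | inj₂ (inj₂ (refl , refl)) = ⊥-elim (p (proj₁ tree₂))

    w₂-marked : ∀ c → Proper K c → c w₂ ≢ c zero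
    w₂-marked c proper e = proper zero w₂ (new H→K) (sym e)

    root-tree′ : ∀ x → cls S x ≡ active → InTree S′ (root S′ x) (root S′ x)
    root-tree′ x a with view x
    ... | moved _ r _ rewrite r = proj₁ tree₁ , trans (root-stays w₁-stays) (proj₂ tree₁)
    ... | stays p r _ rewrite r =
      let (a′ , e) = root-tree inv x a in a′ , trans (root-stays (λ q → p (trans (sym e) q))) e

    nonroot′ : ∀ x → cls S x ≡ active → root S′ x ≢ x → Forced settled K x
    nonroot′ x a ne with view x
    ... | stays _ r _ = Forced-mono settled G⊑K (nonroot inv x a (λ e → ne (trans r e)))
    -- Only `w₂` stops being a root, and its new edge to vertex 0 forces it out of the base class.
    ... | moved p r _ with x ≟ w₂
    ...   | yes refl = w₂-marked
    ...   | no x≢w₂  = Forced-mono settled G⊑K (nonroot inv x a (λ e → x≢w₂ (trans (sym e) p)))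

    two-sided′ : ∀ r → InTree S′ r r → ∀ c → Proper K c → c r ≢ c zero →
      ∃ λ b → ∀ y → InTree S′ r y → c y ≡ other (c zero) (b xor side S′ y)
    two-sided′ r (a , e) c proper ne with view r
    ... | moved p q _ = ⊥-elim (w₁-stays (trans (cong (root S) (trans (sym q) e)) p))
    ... | stays p q _ with two-sided inv r (a , trans (sym q) e) c (Proper-anti G⊑K proper) ne
                         | two-sided inv w₂ tree₂ c (Proper-anti G⊑K proper) (w₂-marked c proper)
    ...   | b₁ , f₁ | b₂ , f₂ = b₁ , colour
      where
      colour : ∀ y → InTree S′ r y → c y ≡ other (c zero) (b₁ xor side S′ y)
      colour y (ay , ey) with view y
      ... | stays _ ry s rewrite s = f₁ y (ay , trans (sym ry) ey)
      -- A moved `y` makes `r` equal to `w₁`. Both old trees then have a bit, and properness on the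
      -- edge between `i` and `j` lets `flip` reconcile the two.
      ... | moved py ry s rewrite s = trans (f₂ y (ay , py))
        (cong (other (c zero)) (flip-colors b₁ b₂ (side S i) (side S j) (side S y) λ same →
          proper i j (include (grows H→K) i j (new ext))
            (trans (f₁ i (ai , trans (sym ry) ey)) (trans (cong (other (c zero)) same) (sym (f₂ j (aj , refl)))))))

    opposite′ : ∀ x → cls S x ≡ active → root S′ x ≢ x → side S′ x ≡ side S′ (root S′ x) →
      ∃ λ y → InTree S′ (root S′ x) y × side S′ x ≢ side S′ y
    opposite′ x a ne s with root S′ x ≟ w₁
    -- In the merged tree `i` and `j` lie on opposite sides, so one of them is across from `x`.
    ... | yes e rewrite e with differ-from-one {side S′ x} sides-ij
    ...   | inj₁ d = i , tree-i , d
    ...   | inj₂ d = j , tree-j , d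
    opposite′ x a ne s | no ¬e with view x
    ... | moved _ r _ = ⊥-elim (¬e r)
    ... | stays p r q rewrite r
      with opposite inv x a ne (trans (sym q) (trans s (side-stays (λ z → p (trans (sym (proj₂ (root-tree inv x a))) z)))))
    ...   | y , (ay , ry) , d = y , (ay , trans (root-stays (λ z → p (trans (sym ry) z))) ry) , side′-differ (sym ry) d

  merge-inv : Inv K S′
  merge-inv = record
    { colorable = colorable′
    ; zero-cls  = zero-cls inv
    ; forced    = λ x → Forced-mono (cls S x) G⊑K (forced inv x)
    ; root-tree = root-tree′
    ; nonroot   = nonroot′
    ; two-sided = two-sided′
    ; fits      = fits′
    ; opposite  = opposite′
    }

-- The potential

-- The sum of the weights is 3n + #settled − 3 #anchored.
weight : Class → ℕ
weight anchored = 0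
weight settled  = 4
weight active   = 3

potential : Config n → ℕ
potential S = sum (weight ∘ cls S)

settle-gain : ∀ (S : Config n) w → InTree S w w → potential S < potential (resolve S w settled)
settle-gain S w tree = sum-mono-< w pointwise strict
  where
  pointwise : ∀ x → weight (cls S x) ≤ weight (cls (resolve S w settled) x)
  pointwise x with resolveView S w settled x
  ... | at-root _ (a , _) e rewrite e | a = n≤1+n 3
  ... | in-tree _ (a , _) e rewrite e | a = n≤1+n 3
  ... | outside _ e rewrite e = ≤-refl
  strict : weight (cls S w) < weight (cls (resolve S w settled) w)
  strict with resolveView S w settled w
  ... | at-root _ (a , _) e rewrite e | a = ≤-refl
  ... | in-tree ne _ _ = ⊥-elim (ne refl)
  ... | outside ¬i _   = ⊥-elim (¬i tree)

δ-≢ : ∀ {x y : Fin n} → x ≢ y → δ x y ≡ 0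
δ-≢ {x = x} {y} ne = cong ind (dec-false (x ≟ y) ne)

δ-refl : ∀ (x : Fin n) → δ x x ≡ 1
δ-refl x = cong ind (dec-true (x ≟ x) refl)

δ+δ≤1 : ∀ {p q : Fin n} x → p ≢ q → δ p x + δ q x ≤ 1
δ+δ≤1 {p = p} {q} x p≢q with p ≟ x | q ≟ x
... | yes refl | yes refl = ⊥-elim (p≢q refl)
... | yes _    | no _     = ≤-refl
... | no _     | yes _    = ≤-refl
... | no _     | no _     = z≤n

-- The root falls from weight 3 to 0, while `p` and `q` rise from 3 to 4. In the sums, `δ p` and
-- `δ q` record the two gains and three copies of `δ w` pay for the fall; the rest of the tree only
-- gains.
capture-loss : ∀ (S : Config n) {w p q} → InTree S w p → InTree S w q → p ≢ w → q ≢ w → p ≢ q →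
  potential S ≤ potential (resolve S w anchored) + 1
capture-loss S {w} {p} {q} tp tq p≢w q≢w p≢q = +-cancelʳ-≤ 2 _ _ (begin
  potential S + 2                                   ≡⟨ +-assoc (potential S) 1 1 ⟨
  potential S + 1 + 1                               ≡⟨ cong (_+ 1) (sum-+δ f p) ⟨
  sum (λ x → f x + δ p x) + 1                       ≡⟨ sum-+δ (λ x → f x + δ p x) q ⟨
  sum (λ x → f x + δ p x + δ q x)                   ≤⟨ sum-mono-≤ pointwise ⟩
  sum (λ x → g x + δ w x + δ w x + δ w x)           ≡⟨ sum-+δ (λ x → g x + δ w x + δ w x) w ⟩
  sum (λ x → g x + δ w x + δ w x) + 1               ≡⟨ cong (_+ 1) (sum-+δ (λ x → g x + δ w x) w) ⟩
  sum (λ x → g x + δ w x) + 1 + 1                   ≡⟨ cong (λ k → k + 1 + 1) (sum-+δ g w) ⟩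
  sum g + 1 + 1 + 1                                 ≡⟨ +-assoc (sum g + 1) 1 1 ⟩
  sum g + 1 + 2                                     ∎)
  where
  open ≤-Reasoning
  f g : Fin _ → ℕ
  f = weight ∘ cls S
  g = weight ∘ cls (resolve S w anchored)
  pointwise : ∀ x → f x + δ p x + δ q x ≤ g x + δ w x + δ w x + δ w x
  pointwise x with resolveView S w anchored x
  ... | at-root refl (a , _) e rewrite e | a | δ-≢ p≢w | δ-≢ q≢w | δ-refl x = ≤-refl
  ... | in-tree x≢w (a , _) e rewrite e | a | δ-≢ (x≢w ∘ sym) = +-monoʳ-≤ 3 (δ+δ≤1 x p≢q)
  ... | outside ¬i e rewrite e | δ-≢ {x = p} {x} (λ { refl → ¬i tp }) | δ-≢ {x = q} {x} (λ { refl → ¬i tq }) =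
    +-mono-≤ (+-mono-≤ (m≤m+n (f x) _) z≤n) z≤n

settled≢active : settled ≢ active
settled≢active ()

-- Mini's replies

-- Marking keeps the graph colourable because recolouring takes every tree, including its root, off
-- the base colour.
mark-inv : ∀ {S w} → Inv {n} G S → InTree S w w → Inv (addEdge G zero w) (resolve S w settled)
mark-inv {G = G} {S} {w} inv tree@(a , _) =
  resolve-inv inv tree settled≢active (grows ext) (_ , proper′) marked local
  where
  ext = addEdge-extends G zero w
  c = proj₁ (colorable inv)
  β = false
  proper′ : Proper (addEdge G zero w) (recolor S c β)
  proper′ = Proper-extend ext
    (recolor-proper G S c β (anchored-const inv (⊑-refl {G = G}) (proj₂ (colorable inv)))
      (λ x y xy _ _ → proj₂ (colorable inv) x y xy) (fits inv))
    λ e → other≢ (c zero) _ (trans (sym (recolor-active S c β a))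
      (trans (sym e) (recolor-passive S c β (anchored≢active (zero-cls inv)))))
  marked : Forced settled (addEdge G zero w) w
  marked c proper e = proper zero w (new ext) (sym e)
  local : ∀ x y → adj (addEdge G zero w) x y ≡ true → cls (resolve S w settled) x ≡ active → adj G x y ≡ true
  local x y xy a′ with only ext x y xy | resolve-active S w settled x settled≢active a′
  ... | inj₁ e                 | _      = e
  ... | inj₂ (inj₁ (refl , _)) | p , _  = ⊥-elim (active≢zero inv p refl)
  ... | inj₂ (inj₂ (refl , _)) | _ , ne = ⊥-elim (ne (proj₂ tree))

mark-join-inv : ∀ {S i j} → Inv {n} G S → Extends G i j H → Colorable3 H →
  cls S i ≡ settled → cls S j ≡ active → Inv (addEdge H zero (root S j)) (resolve S (root S j) settled)
mark-join-inv {n} {G} {H} {S} {i} {j} inv ext (c , proper) si aj =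
  resolve-inv inv tree settled≢active (⊑-trans (grows ext) (grows ext′)) (_ , proper′) marked local
  where
  w = root S j
  tree : InTree S w w
  tree = root-tree inv j aj
  ext′ = addEdge-extends H zero w
  i≢active : cls S i ≢ active
  i≢active e = settled≢active (trans (sym si) e)
  ci = other-surjective (c zero) (c i) (settled-differ inv (grows ext) proper i si)
  β = not (proj₁ ci) xor side S j
  xor-twice : ∀ a b → (a xor b) xor b ≡ a
  xor-twice = from-yes (allBool? λ a → allBool? λ b → ((a xor b) xor b) Bool.≟ a)
  ij-differ : recolor S c β i ≢ recolor S c β j
  ij-differ e = not-¬ {proj₁ ci} refl (trans (other-injective (c zero)
    (trans (sym (proj₂ ci)) (trans (sym (recolor-passive S c β i≢active)) (trans e (recolor-active S c β aj)))))
    (xor-twice (not (proj₁ ci)) (side S j)))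
  proper′ : Proper (addEdge H zero w) (recolor S c β)
  proper′ = Proper-extend ext′ (Proper-extend ext
    (recolor-proper G S c β (anchored-const inv (grows ext) proper)
      (λ x y xy _ _ → Proper-anti (grows ext) proper x y xy) (fits inv))
    ij-differ)
    λ e → other≢ (c zero) _ (trans (sym (recolor-active S c β (proj₁ tree)))
      (trans (sym e) (recolor-passive S c β (anchored≢active (zero-cls inv)))))
  marked : Forced settled (addEdge H zero w) w
  marked c proper e = proper zero w (new ext′) (sym e)
  local : ∀ x y → adj (addEdge H zero w) x y ≡ true → cls (resolve S w settled) x ≡ active → adj G x y ≡ true
  local x y xy a′ with only ext′ x y xy | resolve-active S w settled x settled≢active a′
  ... | inj₂ (inj₁ (refl , _)) | p , _  = ⊥-elim (active≢zero inv p refl)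
  ... | inj₂ (inj₂ (refl , _)) | _ , ne = ⊥-elim (ne (proj₂ tree))
  ... | inj₁ e | p , ne with only ext x y e
  ...   | inj₁ e′                = e′
  ...   | inj₂ (inj₁ (refl , _)) = ⊥-elim (i≢active p)
  ...   | inj₂ (inj₂ (refl , _)) = ⊥-elim (ne refl)

-- Here `k` is the potential before Max's move. In `free` Mini's move is still unspent, so a loss of
-- one is tolerable: marking a further root regains it. In `mark` the move is spent on restoring the
-- invariant, and no loss is allowed.
data Reply (H : Graph (suc n)) (k : ℕ) : Set where
  free : ∀ S → Inv H S → k ≤ potential S + 1 → Reply H k
  mark : ∀ w S → Fin.zero {n} Fin.< w → adj H zero w ≡ false → Inv (addEdge H zero w) S → k ≤ potential S → Reply H k

≢zero⇒> : ∀ {x : Fin (suc n)} → x ≢ zero → Fin.zero {n} Fin.< x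
≢zero⇒> {x = zero}  ne = ⊥-elim (ne refl)
≢zero⇒> {x = suc x} ne = s≤s z≤n

unchanged : ∀ {S i j} → Inv {n} G S → Extends G i j H → Colorable3 H → Fits S i j → Fits S j i →
  Reply H (potential S)
unchanged {H = H} {S} inv ext col ij ji = free S (keep inv (grows ext) col fit) (m≤m+n _ 1)
  where
  fit : ∀ x y → adj H x y ≡ true → Fits S x y
  fit x y xy with only ext x y xy
  ... | inj₁ e                    = fits inv x y e
  ... | inj₂ (inj₁ (refl , refl)) = ij
  ... | inj₂ (inj₂ (refl , refl)) = ji

reply-passive-active : ∀ {S i j} → Inv {n} G S → Extends G i j H → Colorable3 H →
  cls S i ≢ active → cls S j ≡ active → Reply H (potential S)
reply-passive-active {n} {G} {H} {S} {i} {j} inv ext col ¬ai aj with cls S i in si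
... | active = ⊥-elim (¬ai refl)
... | settled = mark (root S j) _ (≢zero⇒> (active≢zero inv (proj₁ tree)))
  (root-fresh inv tree ext i≢0 (active≢zero inv aj))
  (mark-join-inv inv ext col si aj) (<⇒≤ (settle-gain S _ tree))
  where
  tree = root-tree inv j aj
  i≢0 : i ≢ zero
  i≢0 refl with () ← trans (sym si) (zero-cls inv)
... | anchored with root S j ≟ j
...   | no ne = unchanged inv ext col
  (λ ai → ⊥-elim (anchored≢active si ai)) (λ _ → inj₁ (si , ne))
-- Max's own edge into the base class does the marking of the root `j`, so Mini keeps her move.
...   | yes e = free _ (resolve-inv inv tree settled≢active (grows ext) col marked local)
  (≤-trans (<⇒≤ (settle-gain S j tree)) (m≤m+n _ 1))
  where
  tree : InTree S j j
  tree = aj , e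
  marked : Forced settled H j
  marked c proper e = proper i j (new ext) (trans (anchored-const inv (grows ext) proper i si) (sym e))
  local : ∀ x y → adj H x y ≡ true → cls (resolve S j settled) x ≡ active → adj G x y ≡ true
  local x y xy a′ with only ext x y xy | resolve-active S j settled x settled≢active a′
  ... | inj₁ e′                | _      = e′
  ... | inj₂ (inj₁ (refl , _)) | p , _  = ⊥-elim (anchored≢active si p)
  ... | inj₂ (inj₂ (refl , _)) | _ , ne = ⊥-elim (ne (proj₂ tree))

-- If neither end is the root, the two ends serve. If one is, the other end lies on the root's side,
-- and `opposite` yields a vertex across from both.
two-nonroots : ∀ {S i j} → Inv {n} G S → cls S i ≡ active → InTree S (root S i) j → side S i ≡ side S j → i ≢ j →
  ∃ λ p → ∃ λ q → InTree S (root S i) p × InTree S (root S i) q × p ≢ root S i × q ≢ root S i × p ≢ q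
two-nonroots {S = S} {i} {j} inv ai (aj , rj) s i≢j with i ≟ root S i | j ≟ root S i
... | no ne | no ne′ = i , j , (ai , refl) , (aj , rj) , ne , ne′ , i≢j
... | yes e | yes e′ = ⊥-elim (i≢j (trans e (sym e′)))
... | yes e | no ne with opposite inv j aj (λ z → ne (trans (sym z) rj)) (trans (sym s) (cong (side S) (trans e (sym rj))))
...   | y , (ay , ry) , d = j , y , (aj , rj) , (ay , trans ry rj) , ne ,
  (λ z → d (trans (sym s) (cong (side S) (trans e (sym z))))) , λ z → d (cong (side S) z)
two-nonroots {S = S} {i} {j} inv ai (aj , rj) s i≢j | no ne | yes e
  with opposite inv i ai (λ z → ne (sym z)) (trans s (cong (side S) e))
...   | y , (ay , ry) , d = i , y , (ai , refl) , (ay , ry) , ne ,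
  (λ z → d (trans s (cong (side S) (trans e (sym z))))) , λ z → d (cong (side S) z)

reply-odd-cycle : ∀ {S i j} → Inv {n} G S → Extends G i j H → Colorable3 H → i ≢ j →
  cls S i ≡ active → InTree S (root S i) j → side S i ≡ side S j → Reply H (potential S)
reply-odd-cycle {n} {G} {H} {S} {i} {j} inv ext col i≢j ai tj s
  with two-nonroots inv ai tj s i≢j
... | p , q , tp , tq , p≢w , q≢w , p≢q =
  free _ (resolve-inv inv tree (λ ()) (grows ext) col captured local) (capture-loss S tp tq p≢w q≢w p≢q)
  where
  w = root S i
  tree : InTree S w w
  tree = root-tree inv i ai
  -- If the root avoided the base colour, `two-sided` would give `i` and `j`, which lie on the same
  -- side, equal colours despite the new edge.
  captured : Forced anchored H w
  captured c proper with c w ≟ c zero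
  ... | yes e = e
  ... | no ne with two-sided inv w tree c (Proper-anti (grows ext) proper) ne
  ...   | b , f = ⊥-elim (proper i j (new ext)
    (trans (f i (ai , refl)) (trans (cong (λ t → other (c zero) (b xor t)) s) (sym (f j tj)))))
  local : ∀ x y → adj H x y ≡ true → cls (resolve S w anchored) x ≡ active → adj G x y ≡ true
  local x y xy a′ with only ext x y xy | resolve-active S w anchored x (λ ()) a′
  ... | inj₁ e′                | _      = e′
  ... | inj₂ (inj₁ (refl , _)) | _ , ne = ⊥-elim (ne refl)
  ... | inj₂ (inj₂ (refl , _)) | _ , ne = ⊥-elim (ne (proj₂ tj))

reply : ∀ {S i j} → Inv {n} G S → Extends G i j H → Colorable3 H → i ≢ j → Reply H (potential S)
reply {S = S} {i} {j} inv ext col i≢j with active? (cls S i) | active? (cls S j)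
... | no ¬ai | no ¬aj = unchanged inv ext col (⊥-elim ∘ ¬ai) (⊥-elim ∘ ¬aj)
... | no ¬ai | yes aj = reply-passive-active inv ext col ¬ai aj
... | yes ai | no ¬aj = reply-passive-active inv (Extends-sym ext) col ¬aj ai
... | yes ai | yes aj with root S i ≟ root S j
-- Merging changes no class, so the potential is exactly preserved.
...   | no apart = mark (root S j) _ (≢zero⇒> (active≢zero inv (proj₁ tree)))
  (root-fresh inv tree ext (active≢zero inv ai) (active≢zero inv aj))
  (Merge.merge-inv inv ext col ai aj apart) ≤-refl
  where tree = root-tree inv j aj
...   | yes same with side S i Bool.≟ side S j
...     | yes s = reply-odd-cycle inv ext col i≢j ai (aj , sym same) s
...     | no ne = unchanged inv ext col
  (λ _ → inj₂ ((aj , sym same) , ne)) (λ _ → inj₂ ((ai , same) , ne ∘ sym))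

initial : Config (suc n)
initial = config (λ { zero → anchored ; (suc _) → active }) (λ x → x) (λ _ → false)

initial-inv : Inv (emptyGraph (suc n)) initial
initial-inv = record
  { colorable = (λ _ → zero) , λ _ _ ()
  ; zero-cls  = refl
  ; forced    = λ { zero → λ _ _ → refl ; (suc _) → tt }
  ; root-tree = λ x a → a , refl
  ; nonroot   = λ x _ ne → ⊥-elim (ne refl)
  ; two-sided = λ r _ c _ ne → proj₁ (other-surjective (c zero) (c r) ne) ,
      λ { y (_ , refl) → trans (proj₂ (other-surjective (c zero) (c y) ne)) (cong (other (c zero)) (sym (xor-identityʳ _))) }
  ; fits      = λ _ _ ()
  ; opposite  = λ x _ ne _ → ⊥-elim (ne refl)
  }

-- Playing the game

-- Quantified over all proper colourings so that it persists under every later move.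
SmallClass : Graph (suc n) → Set
SmallClass {n} G = ∀ c → Proper G c → 4 * classSize c (c zero) ≤ suc n + 4

-- Weight plus four times membership in the base class is at most 4 at each vertex: anchored
-- vertices weigh 0, and settled ones weigh 4 but lie outside. Summing over the vertices and
-- cancelling the lower bound on the potential leaves the claim.
smallClass : ∀ {S} → Inv {n} G S → (∀ x → cls S x ≢ active) → 3 * suc n ≤ potential S + 4 → SmallClass G
smallClass {n} {G} {S} inv passive large c proper = +-cancelˡ-≤ (3 * suc n) _ _ (begin
  3 * suc n + 4 * X          ≤⟨ +-monoˡ-≤ (4 * X) large ⟩
  potential S + 4 + 4 * X    ≡⟨ shuffle (potential S) (4 * X) ⟩
  potential S + 4 * X + 4    ≡⟨ cong (λ k → potential S + k + 4) (*-distribˡ-sum 4 (λ x → δ (c x) (c zero))) ⟩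
  potential S + sum (λ x → 4 * δ (c x) (c zero)) + 4 ≡⟨ cong (_+ 4) (∑-distrib-+ (weight ∘ cls S) (λ x → 4 * δ (c x) (c zero))) ⟨
  sum (λ x → weight (cls S x) + 4 * δ (c x) (c zero)) + 4 ≤⟨ +-monoˡ-≤ 4 (sum-mono-≤ pointwise) ⟩
  sum {suc n} (λ _ → 4) + 4  ≡⟨ cong (_+ 4) (sum-const (suc n) 4) ⟩
  suc n * 4 + 4              ≡⟨ collect (suc n) ⟩
  3 * suc n + (suc n + 4)    ∎)
  where
  open ≤-Reasoning
  X = classSize c (c zero)
  shuffle : ∀ a b → a + 4 + b ≡ a + b + 4
  shuffle = solve-∀
  collect : ∀ a → a * 4 + 4 ≡ 3 * a + (a + 4)
  collect = solve-∀
  pointwise : ∀ x → weight (cls S x) + 4 * δ (c x) (c zero) ≤ 4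
  pointwise x with cls S x in e
  ... | active   = ⊥-elim (passive x e)
  ... | anchored = *-monoʳ-≤ 4 (≤-trans (m≤m+n (δ (c x) (c zero)) _) (≤-reflexive (δ-partition (c zero) (c x))))
  ... | settled rewrite δ-≢ (settled-differ inv (⊑-refl {G = G}) proper x e) = ≤-refl

-- Edge counts are integers, so rounding down loses nothing; the term `64 * n` corresponds to the
-- constant C = 1.
bound : ℕ → ℕ
bound n = (21 * (n * n) + 64 * n) / 64

finish : (G : Graph (suc n)) → SmallClass G → Colorable3 G → edgeCount G ≤ bound (suc n)
finish {n} G small (c , proper) = begin
  edgeCount G            ≡⟨ m*n/n≡m (edgeCount G) 64 ⟨
  edgeCount G * 64 / 64  ≡⟨ cong (_/ 64) (*-comm (edgeCount G) 64) ⟩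
  64 * edgeCount G / 64  ≤⟨ /-monoˡ-≤ 64 (edgeCount-bound G c (c zero) proper (small c proper)) ⟩
  bound (suc n)          ∎
  where open ≤-Reasoning

-- `SmallClass` already bounds every final graph, so Mini plays whatever legal move the search
-- returns.
endgame : ∀ p (G : Graph (suc n)) → Acc _<_ (nonEdges G) → SmallClass G → Colorable3 G →
  MiniForces (bound (suc n)) p G
endgame p G (acc rs) small col with legalMove? G
... | no stuck = done (λ i j legal → stuck (i , j , legal)) (finish G small col)
... | yes (i , j , legal) = move p
  where
  next : ∀ q i j → Legal G i j → MiniForces _ q (addEdge G i j)
  next q i j (_ , fresh , col′) = endgame q _ (rs (nonEdges-< ext fresh))
    (λ c proper → small c (Proper-anti (grows ext) proper)) col′
    where ext = addEdge-extends G i j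
  move : ∀ p → MiniForces _ p G
  move mini = miniMove i j legal (next maxi i j legal)
  move maxi = maxMove (λ stuck → stuck i j legal) (next mini)

mark-legal : ∀ {S w} → Inv {n} G S → InTree S w w → Legal G zero w
mark-legal inv tree =
  ≢zero⇒> (active≢zero inv (proj₁ tree)) , ¬-not (root-unmarked inv tree) , colorable (mark-inv inv tree)

mutual
  -- The slack is 3 before Max moves and 4 before Mini moves. A `free` reply may cost one unit,
  -- which marking a root in `mini-turn` earns back; a `mark` reply costs nothing and leads straight
  -- back to Max.
  max-turn : ∀ (G : Graph (suc n)) S → Acc _<_ (nonEdges G) → Inv G S → 3 * suc n ≤ potential S + 3 →
    MiniForces (bound (suc n)) maxi G
  max-turn {n} G S (acc rs) inv large with legalMove? G
  ... | no stuck = done (λ i j legal → stuck (i , j , legal))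
    (finish G (smallClass inv passive (≤-trans large (+-monoʳ-≤ (potential S) (n≤1+n 3)))) (colorable inv))
    where
    passive : ∀ x → cls S x ≢ active
    -- A remaining tree would offer a legal move, namely marking its root.
    passive x a = stuck (zero , root S x , mark-legal inv (root-tree inv x a))
  ... | yes (i , j , legal) = maxMove (λ stuck → stuck i j legal) answer
    where
    answer : ∀ i j → Legal G i j → MiniForces (bound (suc n)) mini (addEdge G i j)
    answer i j (i<j , fresh , col) with reply inv (addEdge-extends G i j) col (<⇒≢ i<j)
    ... | free S′ inv′ loss = mini-turn _ S′ (rs (nonEdges-< (addEdge-extends G i j) fresh)) inv′
      (≤-trans large (≤-trans (+-monoˡ-≤ 3 loss) (≤-reflexive (+-assoc (potential S′) 1 3))))
    ... | mark w S′ 0<w fresh′ inv′ gain = miniMove zero w (0<w , fresh′ , colorable inv′)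
      (max-turn _ S′ (rs (<-trans (nonEdges-< (addEdge-extends (addEdge G i j) zero w) fresh′)
                                  (nonEdges-< (addEdge-extends G i j) fresh)))
        inv′ (≤-trans large (+-monoˡ-≤ 3 gain)))

  mini-turn : ∀ (G : Graph (suc n)) S → Acc _<_ (nonEdges G) → Inv G S → 3 * suc n ≤ potential S + 4 →
    MiniForces (bound (suc n)) mini G
  mini-turn G S (acc rs) inv large with any? (λ x → active? (cls S x))
  ... | no none = endgame mini G (acc rs) (smallClass inv (λ x a → none (x , a)) large) (colorable inv)
  ... | yes (x , a) = miniMove zero w legal
    (max-turn _ _ (rs (nonEdges-< (addEdge-extends G zero w) (proj₁ (proj₂ legal)))) (mark-inv inv tree)
      (≤-trans large (≤-trans (≤-reflexive (+-suc (potential S) 3)) (+-monoˡ-≤ 3 (settle-gain S w tree)))))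
    where
    w = root S x
    tree : InTree S w w
    tree = root-tree inv x a
    legal : Legal G zero w
    legal = mark-legal inv tree

-- The initial slack 3 is the weight missing at vertex 0, which is anchored from the start.
initial-potential : ∀ n → 3 * suc n ≤ potential (initial {n}) + 3
initial-potential n = ≤-reflexive (begin
  3 * suc n         ≡⟨ shuffle n ⟩
  n * 3 + 3         ≡⟨ cong (_+ 3) (sum-const n 3) ⟨
  sum {n} (λ _ → 3) + 3 ∎)
  where
  open ≡-Reasoning
  shuffle : ∀ n → 3 * suc n ≡ n * 3 + 3
  shuffle = solve-∀

theorem1p4 : Σ ℕ λ C → (n : ℕ) → (p : Player) →
    Σ ℕ λ k → (64 * k ≤ 21 * (n * n) + 64 * C * n) × ScoreAtMost n p k
theorem1p4 = 1 , λ n p → bound n ,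
  ≤-trans (≤-reflexive (*-comm 64 (bound n))) (m/n*n≤m (21 * (n * n) + 64 * n) 64) , score n p
  where
  score : ∀ n p → ScoreAtMost n p (bound n)
  score zero    p    = done (λ ()) z≤n
  score (suc n) mini = mini-turn (emptyGraph (suc n)) initial (<-wellFounded _) initial-inv
    (≤-trans (initial-potential n) (+-monoʳ-≤ (potential (initial {n})) (n≤1+n 3)))
  score (suc n) maxi = max-turn (emptyGraph (suc n)) initial (<-wellFounded _) initial-inv (initial-potential n)
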